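{- Let $n\ge1$, $\mathcal I=\{1,\dots,n\}$, and for each $i\in\mathcal I$ let $\mathcal X_i,\mathcal Y_i,\mathcal W_i$ be finite nonempty sets and $g_i:\mathcal W_i\times\mathcal X_i\to[0,1]$ a gain function. Let $\mathcal X=\mathcal X_1\times\cdots\times\mathcal X_n$, $\mathcal W=\mathcal W_1\times\cdots\times\mathcal W_n$, and let $g:\mathcal W\times\mathcal X\to[0,1]$ be a joint gain function for $g_1,\dots,g_n$. For any jointly supported prior $\pi$ on $\mathcal X$ with marginals $\pi_i$ and with $V_g(\pi)>0$, and any channels $(\mathcal X_i,\mathcal Y_i,C_i)$, $i\in\mathcal I$, $$\sum_{i\in\mathcal I}I_{g_i}(\pi_i,C_i)-\log\frac{M^{\max}_{g,\pi}}{M^{\min}_{g,\pi}}\ \le\ I_g\Bigl(\pi,\prod_{i\in\mathcal I}C_i\Bigr)\ \le\ \sum_{i\in\mathcal I}I_{g_i}(\pi_i,C_i)+\log\frac{M^{\max}_{g,\pi}}{M^{\min}_{g,\pi}}.$$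
   Context: A (discrete) channel $(\mathcal X,\mathcal Y,C)$ consists of finite sets $\mathcal X,\mathcal Y$ and a matrix $C$ with entries $C[x,y]\ge 0$ and $\sum_{y}C[x,y]=1$ for each $x$. A prior is a probability distribution. The $n$-ary parallel composition (with distinct inputs) $\prod_{i\in\mathcal I}C_i=C_1\times\cdots\times C_n$ is the channel from $\mathcal X_1\times\cdots\times\mathcal X_n$ to $\mathcal Y_1\times\cdots\times\mathcal Y_n$ whose entry at $((x_1,\dots,x_n),(y_1,\dots,y_n))$ is $\prod_{i}C_i[x_i,y_i]$. For a gain function $g:\mathcal W\times\mathcal X\to[0,1]$: $V_g(\pi)=\max_{w\in\mathcal W}\sum_{x}\pi[x]g(w,x)$, $V_g(\pi,C)=\sum_{y}\max_{w\in\mathcal W}\sum_x\pi[x]C[x,y]g(w,x)$, and the $g$-leakage is $I_g(\pi,C)=-\log V_g(\pi)+\log V_g(\pi,C)$. Logarithms are to base 2. A joint gain function $g$ for $g_1,\dots,g_n$ is required to satisfy: $g(\overline w,\overline x)=0$ if and only if $\prod_i g_i(w_i,x_i)=0$, where $\overline w=(w_1,\dots,w_n)$, $\overline x=(x_1,\dots,x_n)$ (no other relation is assumed). $\pi_i$ denotes the marginal of $\pi$ on $\mathcal X_i$. $\pi$ is jointly supported if for all $\overline x\in\mathcal X$, $\prod_i\pi_i[x_i]\neq0$ implies $\pi[\overline x]\ne0$. For $\overline w\in\mathcal W$ let $\mathcal S_{\overline w}=\{\overline x\in\mathcal X:\pi[\overline x]\,g(\overline w,\overline x)\ne0\}$.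 $M^{\min}_{g,\pi}$ (resp. $M^{\max}_{g,\pi}$) is the minimum (resp. maximum), over all $\overline w\in\mathcal W$ and $\overline x\in\mathcal S_{\overline w}$, of $$\frac{\prod_{i\in\mathcal I}\pi_i[x_i]g_i(w_i,x_i)}{\pi[\overline x]\cdot g(\overline w,\overline x)}.$$ Those $\overline w$ with $\mathcal S_{\overline w}=\emptyset$ are ignored; $V_g(\pi)>0$ guarantees that some $\mathcal S_{\overline w}$ is nonempty. -}

module Defs where

open import Algebra.Bundles using (CommutativeRing)
open import Data.Bool.Base using (if_then_else_)
open import Data.Empty using (⊥-elim)
open import Data.Fin.Base using (Fin; zero; suc)
import Data.Fin.Properties as Fin
import Data.List.Base as List
import Data.List.Extrema
open import Data.List.Base using (List)
open import Data.List.Membership.Propositional using (_∈_; lose)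
open import Data.List.Membership.Propositional.Properties
  using (∈-tabulate⁺; ∈-cartesianProduct⁺)
open import Data.List.Relation.Unary.All using (universal)
import Data.List.Relation.Unary.All.Properties as All
open import Data.List.Relation.Unary.Any using (any?; satisfied)
open import Data.Nat.Base using (ℕ; zero; suc)
open import Data.Product.Base using (∃; Σ; _×_; _,_; proj₁; proj₂)
open import Data.Product.Function.NonDependent.Propositional using (_×-↔_)
open import Data.Unit.Base using (⊤; tt)
open import Function.Base using (_∘_)
open import Function.Bundles using (_↔_; _⇔_; Inverse)
open import Function.Properties.Inverse using (↔-sym; ↔-trans; ↔⇒↣)
open import Level using (0ℓ)
open import Relation.Binary.Bundles using (DecTotalOrder)
open import Relation.Binary.Core using (Rel)
open import Relation.Binary.Definitions using (DecidableEquality)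
open import Relation.Binary.PropositionalEquality.Core using (subst)
open import Relation.Binary.Structures using (IsDecTotalOrder)
import Relation.Binary.Properties.DecTotalOrder
import Algebra.Properties.Monoid.Sum
open import Relation.Nullary using (¬_; Dec; yes; no; ¬?; does; decidable-stable)
open import Relation.Nullary.Decidable using (via-injection)

-- The classical real numbers, presented by their defining axioms: a
-- complete ordered field.  These axioms fix the structure up to isomorphism.
-- Equality is the setoid equality _≈_, and the order is decidable because the
-- mathematics is classical.

record RealNumbers : Set₁ where
  field
    commutativeRing : CommutativeRing 0ℓ 0ℓ
  open CommutativeRing commutativeRing public hiding (zero) renaming (Carrier to ℝ)

  infix  4 _≤_
  infix  8 _⁻¹
  infixl 7 _÷_

  field
    _≤_             : Rel ℝ 0ℓ
    isDecTotalOrder : IsDecTotalOrder _≈_ _≤_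
    +-monoˡ-≤       : ∀ z {x y} → x ≤ y → x + z ≤ y + z
    *-nonNegative   : ∀ {x y} → 0# ≤ x → 0# ≤ y → 0# ≤ x * y
    0≉1             : ¬ (0# ≈ 1#)
    -- Total for convenience; nothing is assumed about 0# ⁻¹.
    _⁻¹             : ℝ → ℝ
    *-inverseʳ      : ∀ x → ¬ (x ≈ 0#) → x * x ⁻¹ ≈ 1#
    supremum        : (P : ℝ → Set) → ∃ P → ∃ (λ b → ∀ x → P x → x ≤ b) →
                      Σ ℝ λ s → (∀ x → P x → x ≤ s) ×
                                (∀ b → (∀ x → P x → x ≤ b) → s ≤ b)

  decTotalOrder : DecTotalOrder 0ℓ 0ℓ 0ℓ
  decTotalOrder = record { isDecTotalOrder = isDecTotalOrder }

  open DecTotalOrder decTotalOrder public using (totalOrder; _≟_; _≤?_)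
  open Relation.Binary.Properties.DecTotalOrder decTotalOrder public using (_<_)

  _÷_ : ℝ → ℝ → ℝ
  x ÷ y = x * y ⁻¹

-- The base-2 logarithm, as the increasing homomorphism from (ℝ>0, ·) to
-- (ℝ, +) sending 2 to 1; on ℝ>0 there is exactly one such function.  Values at
-- non-positive arguments are left unconstrained.

record IsLog₂ (R : RealNumbers) (log₂ : RealNumbers.ℝ R → RealNumbers.ℝ R) : Set where
  open RealNumbers R
  field
    log-*    : ∀ {x y} → 0# < x → 0# < y → log₂ (x * y) ≈ log₂ x + log₂ y
    log-mono : ∀ {x y} → 0# < x → x ≤ y → log₂ x ≤ log₂ y
    log-2    : log₂ (1# + 1#) ≈ 1#

record NonemptyFiniteSet : Set₁ where
  field
    Element     : Set
    size        : ℕ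
    enumeration : Fin size ↔ Element
    point       : Element

  elements : List Element
  elements = List.tabulate (Inverse.to enumeration)

  _≟ᴱ_ : DecidableEquality Element
  _≟ᴱ_ = via-injection (↔⇒↣ (↔-sym enumeration)) Fin._≟_

  ∈-elements : ∀ x → x ∈ elements
  ∈-elements x = subst (_∈ elements) (Inverse.strictlyInverseˡ enumeration x)
                   (∈-tabulate⁺ {f = Inverse.to enumeration} (Inverse.from enumeration x))

open NonemptyFiniteSet public using (Element)

-- X₁ × ⋯ × Xₙ as iterated pairs rather than as functions on Fin n, so that
-- propositional equality of tuples is componentwise without function
-- extensionality.

Tuple : (n : ℕ) → (Fin n → Set) → Set
Tuple zero    A = ⊤
Tuple (suc n) A = A zero × Tuple n (A ∘ suc)

lookup : ∀ {n} {A : Fin n → Set} → Tuple n A → (i : Fin n) → A i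
lookup (a , _)  zero    = a
lookup (_ , as) (suc i) = lookup as i

⨉ : ∀ {n} → (Fin n → NonemptyFiniteSet) → NonemptyFiniteSet
⨉ {n} X = record
  { Element     = Tuple n (Element ∘ X)
  ; size        = count n X
  ; enumeration = enum n X
  ; point       = pt n X
  }
  where
  open NonemptyFiniteSet using (size; enumeration; point)
  open import Data.Nat.Base using (_*_)

  count : ∀ n → (Fin n → NonemptyFiniteSet) → ℕ
  count zero    X = 1
  count (suc n) X = size (X zero) * count n (X ∘ suc)

  enum : ∀ n (X : Fin n → NonemptyFiniteSet) → Fin (count n X) ↔ Tuple n (Element ∘ X)
  enum zero    X = Fin.1↔⊤
  enum (suc n) X = ↔-trans (Fin.*↔× {size (X zero)} {count n (X ∘ suc)})
                           (enumeration (X zero) ×-↔ enum n (X ∘ suc))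

  pt : ∀ n (X : Fin n → NonemptyFiniteSet) → Tuple n (Element ∘ X)
  pt zero    X = tt
  pt (suc n) X = point (X zero) , pt n (X ∘ suc)

module Leakage (R : RealNumbers) where
  open RealNumbers R
  open NonemptyFiniteSet using (size; enumeration; point; elements; _≟ᴱ_; ∈-elements)
  open Algebra.Properties.Monoid.Sum +-monoid using () renaming (sum to sumFin)
  open Algebra.Properties.Monoid.Sum *-monoid using () renaming (sum to prodFin)
  open Data.List.Extrema totalOrder using (max; min; max≤v⁺)

  ∑ᵢ : ∀ {n} → (Fin n → ℝ) → ℝ
  ∑ᵢ = sumFin

  ∏ᵢ : ∀ {n} → (Fin n → ℝ) → ℝ
  ∏ᵢ = prodFin

  ∑ : (X : NonemptyFiniteSet) → (Element X → ℝ) → ℝ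
  ∑ X f = sumFin (f ∘ Inverse.to (enumeration X))

  -- The element a only witnesses that xs is nonempty; it is meant to satisfy
  -- a ∈ xs, and then the results do not depend on it.
  maximum minimum : {A : Set} → A → List A → (A → ℝ) → ℝ
  maximum a xs f = max (f a) (List.map f xs)
  minimum a xs f = min (f a) (List.map f xs)

  Max : (W : NonemptyFiniteSet) → (Element W → ℝ) → ℝ
  Max W = maximum (point W) (elements W)

  record IsDistribution (X : NonemptyFiniteSet) (π : Element X → ℝ) : Set where
    field
      nonNegative : ∀ x → 0# ≤ π x
      total       : ∑ X π ≈ 1#

  IsChannel : (X Y : NonemptyFiniteSet) → (Element X → Element Y → ℝ) → Set
  IsChannel X Y C = ∀ x → IsDistribution Y (C x)

  IsGain : (W X : NonemptyFiniteSet) → (Element W → Element X → ℝ) → Set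
  IsGain W X g = ∀ w x → (0# ≤ g w x) × (g w x ≤ 1#)

  module _ (W X : NonemptyFiniteSet) (g : Element W → Element X → ℝ) where

    priorV : (Element X → ℝ) → ℝ
    priorV π = Max W λ w → ∑ X λ x → π x * g w x

    posteriorV : (Y : NonemptyFiniteSet) → (Element X → ℝ) →
                 (Element X → Element Y → ℝ) → ℝ
    posteriorV Y π C = ∑ Y λ y → Max W λ w → ∑ X λ x → π x * C x y * g w x

    leakage : (log₂ : ℝ → ℝ) (Y : NonemptyFiniteSet) → (Element X → ℝ) →
              (Element X → Element Y → ℝ) → ℝ
    leakage log₂ Y π C = - log₂ (priorV π) + log₂ (posteriorV Y π C)

  module _ {n : ℕ} where

    marginal : (X : Fin n → NonemptyFiniteSet) → (Element (⨉ X) → ℝ) →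
               (i : Fin n) → Element (X i) → ℝ
    marginal X π i a =
      ∑ (⨉ X) λ x → if does (_≟ᴱ_ (X i) (lookup x i) a) then π x else 0#

    parallel : (X Y : Fin n → NonemptyFiniteSet) →
               (∀ i → Element (X i) → Element (Y i) → ℝ) →
               Element (⨉ X) → Element (⨉ Y) → ℝ
    parallel X Y C x y = ∏ᵢ λ i → C i (lookup x i) (lookup y i)

    JointlySupported : (X : Fin n → NonemptyFiniteSet) → (Element (⨉ X) → ℝ) → Set
    JointlySupported X π =
      ∀ x → ¬ (∏ᵢ (λ i → marginal X π i (lookup x i)) ≈ 0#) → ¬ (π x ≈ 0#)

    IsJointGain : (W X : Fin n → NonemptyFiniteSet) →
                  (∀ i → Element (W i) → Element (X i) → ℝ) →
                  (Element (⨉ W) → Element (⨉ X) → ℝ) → Set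
    IsJointGain W X gᵢ g =
      ∀ w x → (g w x ≈ 0#) ⇔ (∏ᵢ (λ i → gᵢ i (lookup w i) (lookup x i)) ≈ 0#)

  -- Pairs (w , x) with x ∈ S_w.
  module Support (W X : NonemptyFiniteSet) (g : Element W → Element X → ℝ)
                 (π : Element X → ℝ) where

    InS : Element W × Element X → Set
    InS (w , x) = ¬ (π x * g w x ≈ 0#)

    InS? : ∀ p → Dec (InS p)
    InS? (w , x) = ¬? (π x * g w x ≟ 0#)

    pairs : List (Element W × Element X)
    pairs = List.cartesianProduct (elements W) (elements X)

    supportPairs : List (Element W × Element X)
    supportPairs = List.filter InS? pairs

    private
      open DecTotalOrder decTotalOrder using (antisym) renaming (reflexive to ≤-reflexive)

      sumFin-zero : ∀ {n} (f : Fin n → ℝ) → (∀ i → f i ≈ 0#) → sumFin f ≈ 0#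
      sumFin-zero {zero}  f f≈0 = refl
      sumFin-zero {suc n} f f≈0 =
        trans (+-cong (f≈0 zero) (sumFin-zero (f ∘ suc) (f≈0 ∘ suc))) (+-identityˡ 0#)

    positive⇒supported : 0# < priorV W X g π → ∃ InS
    positive⇒supported (0≤V , 0≉V) with any? InS? pairs
    ... | yes p = satisfied p
    ... | no ¬p = ⊥-elim (0≉V (antisym 0≤V V≤0))
      where
      vanish : ∀ w x → π x * g w x ≈ 0#
      vanish w x = decidable-stable (π x * g w x ≟ 0#) λ s →
        ¬p (lose (∈-cartesianProduct⁺ (∈-elements W w) (∈-elements X x)) s)

      row≤0 : ∀ w → ∑ X (λ x → π x * g w x) ≤ 0#
      row≤0 w = ≤-reflexive (sumFin-zero _ (vanish w ∘ Inverse.to (enumeration X)))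

      V≤0 : priorV W X g π ≤ 0#
      V≤0 = max≤v⁺ (row≤0 (point W)) (All.map⁺ (universal row≤0 (elements W)))

  module _ {n : ℕ} (W X : Fin n → NonemptyFiniteSet)
           (gᵢ : ∀ i → Element (W i) → Element (X i) → ℝ)
           (g : Element (⨉ W) → Element (⨉ X) → ℝ)
           (π : Element (⨉ X) → ℝ) where

    open Support (⨉ W) (⨉ X) g π

    ratio : Element (⨉ W) × Element (⨉ X) → ℝ
    ratio (w , x) =
      ∏ᵢ (λ i → marginal X π i (lookup x i) * gᵢ i (lookup w i) (lookup x i))
        ÷ (π x * g w x)

    M-max M-min : 0# < priorV (⨉ W) (⨉ X) g π → ℝ
    M-max V>0 = maximum (proj₁ (positive⇒supported V>0)) supportPairs ratio
    M-min V>0 = minimum (proj₁ (positive⇒supported V>0)) supportPairs ratio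

{-# OPTIONS --safe #-}

-- Put a(w,x) = π[x] g(w,x) and b(w,x) = ∏ᵢ πᵢ[xᵢ] gᵢ(wᵢ,xᵢ).  Joint support and
-- the joint-gain condition say that a and b vanish at the same points, so
-- M-min · a ≤ b ≤ M-max · a everywhere.  These bounds survive multiplication by
-- ∏ᵢ Cᵢ[xᵢ,yᵢ], summation over x, maximisation over w and summation over y,
-- while for b each of these operations factors over the coordinates.  Hence
-- ∏ᵢ V_{gᵢ}(πᵢ) and ∏ᵢ V_{gᵢ}(πᵢ,Cᵢ) lie within the factors M-min and M-max of
-- V_g(π) and V_g(π,∏ᵢCᵢ), and taking logarithms gives both inequalities.

module Submission where

open import Defs
open import Data.Nat.Base as ℕ using (ℕ; zero; suc; NonZero)
open import Data.Fin.Base using (Fin; zero; suc; _↑ˡ_; _↑ʳ_; combine; punchIn)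
import Data.Fin.Properties as Fin
open import Data.Bool.Base using (true; false; if_then_else_)
open import Data.List.Base using (List; map)
import Data.List.Extrema
open import Data.List.Membership.Propositional using (_∈_)
open import Data.List.Membership.Propositional.Properties
  using (∈-map⁺; ∈-filter⁺; ∈-filter⁻; ∈-cartesianProduct⁺)
import Data.List.Relation.Unary.All as All
import Data.List.Relation.Unary.All.Properties as All
open import Data.Product.Base using (∃; _×_; _,_; proj₁; proj₂)
open import Data.Product.Function.NonDependent.Propositional using (_×-↔_)
open import Data.Sum.Base using (inj₁; inj₂)
open import Data.Vec.Functional using (removeAt)
open import Data.Unit.Base using (tt)
open import Function.Base using (_∘_; id)
open import Function.Bundles using (_↔_; Inverse; Equivalence)
open import Function.Properties.Inverse using (↔-sym; ↔-trans)
open import Relation.Binary.Bundles using (DecTotalOrder)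
open import Relation.Binary.PropositionalEquality.Core as ≡ using (_≡_)
open import Relation.Nullary using (¬_; yes; no; does; contradiction)
open import Relation.Nullary.Decidable using (dec-true; decidable-stable)
import Algebra.Properties.CommutativeMonoid.Sum
import Algebra.Properties.CommutativeSemigroup
import Algebra.Properties.Group
import Algebra.Properties.Ring
import Algebra.Properties.Semiring.Sum
import Algebra.Solver.CommutativeMonoid
import Relation.Binary.Reasoning.PartialOrder

-- Order and division in an ordered field.

module OrderedField (R : RealNumbers) where
  open RealNumbers R
  open DecTotalOrder decTotalOrder public using (antisym; poset; total)
    renaming (refl to ≤-refl; trans to ≤-trans; reflexive to ≤-reflexive)
  open Algebra.Properties.Ring ring using (-‿distribˡ-*; -‿distribʳ-*; x[y-z]≈xy-xz)
  open Algebra.Properties.Group +-group using (⁻¹-involutive; //-rightDividesˡ; //-rightDividesʳ)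
  open Relation.Binary.Reasoning.PartialOrder poset

  +-mono-≤ : ∀ {x y u v} → x ≤ y → u ≤ v → x + u ≤ y + v
  +-mono-≤ {x} {y} {u} {v} x≤y u≤v = begin
    x + u  ≤⟨ +-monoˡ-≤ u x≤y ⟩
    y + u  ≈⟨ +-comm y u ⟩
    u + y  ≤⟨ +-monoˡ-≤ y u≤v ⟩
    v + y  ≈⟨ +-comm v y ⟩
    y + v  ∎

  +≤⇒≤- : ∀ {x y z} → x + y ≤ z → x ≤ z - y
  +≤⇒≤- {x} {y} {z} x+y≤z = begin
    x          ≈⟨ //-rightDividesʳ y x ⟨
    x + y - y  ≤⟨ +-monoˡ-≤ (- y) x+y≤z ⟩
    z - y      ∎

  ≤+⇒-≤ : ∀ {x y z} → x ≤ y + z → x - z ≤ y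
  ≤+⇒-≤ {x} {y} {z} x≤y+z = begin
    x - z      ≤⟨ +-monoˡ-≤ (- z) x≤y+z ⟩
    y + z - z  ≈⟨ //-rightDividesʳ z y ⟩
    y          ∎

  -- The order axioms speak only of adding a constant and of products of nonnegative elements. So
  -- `z` is multiplied with the nonnegative difference `y - x`, and `z * x` is added back.
  *-monoˡ-≤-nonNeg : ∀ {x y z} → 0# ≤ z → x ≤ y → z * x ≤ z * y
  *-monoˡ-≤-nonNeg {x} {y} {z} 0≤z x≤y = begin
    z * x                      ≈⟨ +-identityˡ _ ⟨
    0# + z * x                 ≤⟨ +-monoˡ-≤ _ (*-nonNegative 0≤z (+≤⇒≤- (≤-trans (≤-reflexive (+-identityˡ x)) x≤y))) ⟩
    z * (y - x) + z * x        ≈⟨ +-congʳ (x[y-z]≈xy-xz z y x) ⟩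
    z * y - z * x + z * x      ≈⟨ //-rightDividesˡ (z * x) (z * y) ⟩
    z * y                      ∎

  *-mono-≤-nonNeg : ∀ {x y u v} → 0# ≤ x → 0# ≤ v → x ≤ y → u ≤ v → x * u ≤ y * v
  *-mono-≤-nonNeg {x} {y} {u} {v} 0≤x 0≤v x≤y u≤v = begin
    x * u  ≤⟨ *-monoˡ-≤-nonNeg 0≤x u≤v ⟩
    x * v  ≈⟨ *-comm x v ⟩
    v * x  ≤⟨ *-monoˡ-≤-nonNeg 0≤v x≤y ⟩
    v * y  ≈⟨ *-comm v y ⟩
    y * v  ∎

  -- For `x ≤ 0` the square equals `- x * - x`, a product of nonnegative elements. This is the
  -- source of `0≤1` and of the sign of inverses, neither of which is an axiom.
  square-nonNeg : ∀ x → 0# ≤ x * x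
  square-nonNeg x with total 0# x
  ... | inj₁ 0≤x = *-nonNegative 0≤x 0≤x
  ... | inj₂ x≤0 = begin
    0#             ≤⟨ *-nonNegative 0≤-x 0≤-x ⟩
    - x * - x      ≈⟨ -‿distribˡ-* x (- x) ⟨
    - (x * - x)    ≈⟨ -‿cong (-‿distribʳ-* x x) ⟨
    - (- (x * x))  ≈⟨ ⁻¹-involutive (x * x) ⟩
    x * x          ∎
    where
    0≤-x : 0# ≤ - x
    0≤-x = begin
      0#      ≤⟨ +≤⇒≤- (≤-trans (≤-reflexive (+-identityˡ x)) x≤0) ⟩
      0# - x  ≈⟨ +-identityˡ (- x) ⟩
      - x     ∎

  0≤1 : 0# ≤ 1#
  0≤1 = ≤-trans (square-nonNeg 1#) (≤-reflexive (*-identityˡ 1#))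

  0<1 : 0# < 1#
  0<1 = 0≤1 , 0≉1

  nonNeg∧≉0⇒0< : ∀ {x} → 0# ≤ x → ¬ (x ≈ 0#) → 0# < x
  nonNeg∧≉0⇒0< 0≤x x≉0 = 0≤x , x≉0 ∘ sym

  0<⇒≉0 : ∀ {x} → 0# < x → ¬ (x ≈ 0#)
  0<⇒≉0 (_ , 0≉x) = 0≉x ∘ sym

  0<-≤-trans : ∀ {x y} → 0# < x → x ≤ y → 0# < y
  0<-≤-trans (0≤x , 0≉x) x≤y =
    ≤-trans 0≤x x≤y , λ 0≈y → 0≉x (antisym 0≤x (≤-trans x≤y (≤-reflexive (sym 0≈y))))

  -- The inverse is `x` times its own square, `x * (x ⁻¹ * x ⁻¹)`, so no case distinction on its
  -- sign arises.
  ⁻¹-nonNeg : ∀ {x} → 0# < x → 0# ≤ x ⁻¹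
  ⁻¹-nonNeg {x} 0<x@(0≤x , _) = begin
    0#                   ≤⟨ *-nonNegative 0≤x (square-nonNeg (x ⁻¹)) ⟩
    x * (x ⁻¹ * x ⁻¹)    ≈⟨ *-assoc x _ _ ⟨
    x * x ⁻¹ * x ⁻¹      ≈⟨ *-congʳ (*-inverseʳ x (0<⇒≉0 0<x)) ⟩
    1# * x ⁻¹            ≈⟨ *-identityˡ _ ⟩
    x ⁻¹                 ∎

  ÷-*-cancel : ∀ x {y} → ¬ (y ≈ 0#) → x ÷ y * y ≈ x
  ÷-*-cancel x {y} y≉0 = begin-equality
    x * y ⁻¹ * y    ≈⟨ *-assoc x _ y ⟩
    x * (y ⁻¹ * y)  ≈⟨ *-congˡ (trans (*-comm _ y) (*-inverseʳ y y≉0)) ⟩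
    x * 1#          ≈⟨ *-identityʳ x ⟩
    x               ∎

  *-≉0 : ∀ {x y} → ¬ (x ≈ 0#) → ¬ (y ≈ 0#) → ¬ (x * y ≈ 0#)
  *-≉0 {x} {y} x≉0 y≉0 xy≈0 = x≉0 (begin-equality
    x             ≈⟨ ÷-*-cancel x y≉0 ⟨
    x * y ⁻¹ * y  ≈⟨ trans (*-assoc x _ y) (*-congˡ (*-comm _ y)) ⟩
    x * (y * y ⁻¹) ≈⟨ *-assoc x y _ ⟨
    x * y * y ⁻¹  ≈⟨ *-congʳ xy≈0 ⟩
    0# * y ⁻¹     ≈⟨ zeroˡ _ ⟩
    0#            ∎)

  *-≉0ˡ : ∀ {x y} → ¬ (x * y ≈ 0#) → ¬ (x ≈ 0#)
  *-≉0ˡ {x} {y} xy≉0 x≈0 = xy≉0 (trans (*-congʳ x≈0) (zeroˡ y))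

  *-≉0ʳ : ∀ {x y} → ¬ (x * y ≈ 0#) → ¬ (y ≈ 0#)
  *-≉0ʳ {x} {y} xy≉0 y≈0 = xy≉0 (trans (*-congˡ y≈0) (zeroʳ x))

  *-positive : ∀ {x y} → 0# < x → 0# < y → 0# < x * y
  *-positive 0<x@(0≤x , _) 0<y@(0≤y , _) =
    nonNeg∧≉0⇒0< (*-nonNegative 0≤x 0≤y) (*-≉0 (0<⇒≉0 0<x) (0<⇒≉0 0<y))

  ÷-positive : ∀ {x y} → 0# < x → 0# < y → 0# < x ÷ y
  ÷-positive {x} {y} 0<x@(0≤x , _) 0<y = nonNeg∧≉0⇒0<
    (*-nonNegative 0≤x (⁻¹-nonNeg 0<y))
    λ x÷y≈0 → 0<⇒≉0 0<x (trans (sym (÷-*-cancel x (0<⇒≉0 0<y))) (trans (*-congʳ x÷y≈0) (zeroˡ y)))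

-- Finite sums, products and extrema, and their exchange.

module BigOperators (R : RealNumbers) where
  open RealNumbers R
  open Leakage R
  open OrderedField R
  open NonemptyFiniteSet using (size; enumeration; point; elements; ∈-elements)
  open Relation.Binary.Reasoning.PartialOrder poset
  open Algebra.Properties.Semiring.Sum semiring using (*-distribˡ-sum; *-distribʳ-sum)
  open Data.List.Extrema totalOrder using (argmax-all; argmin-all; xs≤max; min≤xs)
  module Sum = Algebra.Properties.CommutativeMonoid.Sum +-commutativeMonoid
  module Product = Algebra.Properties.CommutativeMonoid.Sum *-commutativeMonoid

  ∑ᵢ-mono : ∀ {n} {f h : Fin n → ℝ} → (∀ i → f i ≤ h i) → ∑ᵢ f ≤ ∑ᵢ h
  ∑ᵢ-mono {zero}  f≤h = ≤-refl
  ∑ᵢ-mono {suc n} f≤h = +-mono-≤ (f≤h zero) (∑ᵢ-mono (f≤h ∘ suc))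

  ∑ᵢ-nonNeg : ∀ {n} {f : Fin n → ℝ} → (∀ i → 0# ≤ f i) → 0# ≤ ∑ᵢ f
  ∑ᵢ-nonNeg {zero}  0≤f = ≤-refl
  ∑ᵢ-nonNeg {suc n} 0≤f =
    ≤-trans (≤-reflexive (sym (+-identityˡ 0#))) (+-mono-≤ (0≤f zero) (∑ᵢ-nonNeg (0≤f ∘ suc)))

  term≤∑ᵢ : ∀ {n} {f : Fin n → ℝ} → (∀ i → 0# ≤ f i) → ∀ i → f i ≤ ∑ᵢ f
  term≤∑ᵢ {suc n} {f} 0≤f i = begin
    f i                          ≈⟨ +-identityʳ (f i) ⟨
    f i + 0#                     ≤⟨ +-mono-≤ ≤-refl (∑ᵢ-nonNeg {f = removeAt f i} λ j → 0≤f (punchIn i j)) ⟩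
    f i + ∑ᵢ (removeAt f i)      ≈⟨ Sum.sum-remove f ⟨
    ∑ᵢ f                         ∎

  ∏ᵢ-nonNeg : ∀ {n} {f : Fin n → ℝ} → (∀ i → 0# ≤ f i) → 0# ≤ ∏ᵢ f
  ∏ᵢ-nonNeg {zero}  0≤f = 0≤1
  ∏ᵢ-nonNeg {suc n} 0≤f = *-nonNegative (0≤f zero) (∏ᵢ-nonNeg (0≤f ∘ suc))

  ∏ᵢ-mono : ∀ {n} {f h : Fin n → ℝ} → (∀ i → 0# ≤ f i) → (∀ i → f i ≤ h i) → ∏ᵢ f ≤ ∏ᵢ h
  ∏ᵢ-mono {zero}  0≤f f≤h = ≤-refl
  ∏ᵢ-mono {suc n} 0≤f f≤h = *-mono-≤-nonNeg (0≤f zero)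
    (∏ᵢ-nonNeg λ i → ≤-trans (0≤f (suc i)) (f≤h (suc i)))
    (f≤h zero) (∏ᵢ-mono (0≤f ∘ suc) (f≤h ∘ suc))

  ∏ᵢ-positive : ∀ {n} {f : Fin n → ℝ} → (∀ i → 0# < f i) → 0# < ∏ᵢ f
  ∏ᵢ-positive {zero}  0<f = 0<1
  ∏ᵢ-positive {suc n} 0<f = *-positive (0<f zero) (∏ᵢ-positive (0<f ∘ suc))

  ∏ᵢ≉0⇒≉0 : ∀ {n} {f : Fin n → ℝ} → ¬ (∏ᵢ f ≈ 0#) → ∀ i → ¬ (f i ≈ 0#)
  ∏ᵢ≉0⇒≉0 ∏≉0 zero    = *-≉0ˡ ∏≉0
  ∏ᵢ≉0⇒≉0 ∏≉0 (suc i) = ∏ᵢ≉0⇒≉0 (*-≉0ʳ ∏≉0) i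

  ∑-cong : ∀ X {f h : Element X → ℝ} → (∀ x → f x ≈ h x) → ∑ X f ≈ ∑ X h
  ∑-cong X f≈h = Sum.sum-cong-≋ (f≈h ∘ Inverse.to (enumeration X))

  ∑-mono : ∀ X {f h : Element X → ℝ} → (∀ x → f x ≤ h x) → ∑ X f ≤ ∑ X h
  ∑-mono X f≤h = ∑ᵢ-mono (f≤h ∘ Inverse.to (enumeration X))

  ∑-nonNeg : ∀ X {f : Element X → ℝ} → (∀ x → 0# ≤ f x) → 0# ≤ ∑ X f
  ∑-nonNeg X 0≤f = ∑ᵢ-nonNeg (0≤f ∘ Inverse.to (enumeration X))

  term≤∑ : ∀ X {f : Element X → ℝ} → (∀ x → 0# ≤ f x) → ∀ x → f x ≤ ∑ X f
  term≤∑ X {f} 0≤f x = ≡.subst (λ z → f z ≤ ∑ X f) (Inverse.strictlyInverseˡ (enumeration X) x)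
    (term≤∑ᵢ (0≤f ∘ Inverse.to (enumeration X)) (Inverse.from (enumeration X) x))

  *-distribˡ-∑ : ∀ X c (f : Element X → ℝ) → c * ∑ X f ≈ ∑ X (λ x → c * f x)
  *-distribˡ-∑ X c f = *-distribˡ-sum c (f ∘ Inverse.to (enumeration X))

  *-distribʳ-∑ : ∀ X c (f : Element X → ℝ) → ∑ X f * c ≈ ∑ X (λ x → f x * c)
  *-distribʳ-∑ X c f = *-distribʳ-sum c (f ∘ Inverse.to (enumeration X))

  ∑-comm : ∀ X Y (f : Element X → Element Y → ℝ) →
           ∑ X (λ x → ∑ Y (f x)) ≈ ∑ Y (λ y → ∑ X λ x → f x y)
  ∑-comm X Y f = Sum.∑-comm λ i j → f (Inverse.to (enumeration X) i) (Inverse.to (enumeration Y) j)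

  -- One enumeration followed by the inverse of the other is a permutation of indices, and a finite
  -- sum is invariant under permutations.
  ∑ᵢ-enumeration : ∀ {A : Set} {m n} (e : Fin m ↔ A) (e′ : Fin n ↔ A) (f : A → ℝ) →
                   ∑ᵢ (f ∘ Inverse.to e) ≈ ∑ᵢ (f ∘ Inverse.to e′)
  ∑ᵢ-enumeration e e′ f = trans
    (Sum.sum-permute (f ∘ Inverse.to e) (↔-trans e′ (↔-sym e)))
    (Sum.sum-cong-≋ λ k → reflexive (≡.cong f (Inverse.strictlyInverseˡ e (Inverse.to e′ k))))

  ∑ᵢ-++ : ∀ m {n} (f : Fin (m ℕ.+ n) → ℝ) →
          ∑ᵢ f ≈ ∑ᵢ (λ i → f (i ↑ˡ n)) + ∑ᵢ (λ j → f (m ↑ʳ j))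
  ∑ᵢ-++ zero    f = sym (+-identityˡ _)
  ∑ᵢ-++ (suc m) f = trans (+-congˡ (∑ᵢ-++ m (f ∘ suc))) (sym (+-assoc _ _ _))

  -- `combine` numbers pairs lexicographically, in `m` consecutive blocks of length `n`; each
  -- induction step splits off the first block.
  ∑ᵢ-combine : ∀ m {n} (f : Fin (m ℕ.* n) → ℝ) →
               ∑ᵢ f ≈ ∑ᵢ {m} (λ i → ∑ᵢ {n} (λ j → f (combine i j)))
  ∑ᵢ-combine zero        f = refl
  ∑ᵢ-combine (suc m) {n} f = trans (∑ᵢ-++ n f) (+-congˡ (∑ᵢ-combine m (f ∘ (n ↑ʳ_))))

  -- The enumeration of ⨉ X is not definitionally built from the one of
  -- ⨉ (X ∘ suc), hence the detour through independence of the enumeration.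
  ∑-⨉-suc : ∀ {n} (X : Fin (suc n) → NonemptyFiniteSet) (f : Element (⨉ X) → ℝ) →
            ∑ (⨉ X) f ≈ ∑ (X zero) (λ a → ∑ (⨉ (X ∘ suc)) λ as → f (a , as))
  ∑-⨉-suc X f = begin-equality
    ∑ (⨉ X) f
      ≈⟨ ∑ᵢ-enumeration (enumeration (⨉ X)) e f ⟩
    ∑ᵢ (f ∘ Inverse.to e)
      ≈⟨ ∑ᵢ-combine (size (X zero)) (f ∘ Inverse.to e) ⟩
    ∑ᵢ {size (X zero)} (λ i → ∑ᵢ {size (⨉ (X ∘ suc))} λ j → f (Inverse.to e (combine i j)))
      ≈⟨ Sum.sum-cong-≋ (λ i → Sum.sum-cong-≋ λ j → reflexive
           (≡.cong (f ∘ Inverse.to (e₀ ×-↔ e₁)) (Fin.remQuot-combine i j))) ⟩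
    ∑ (X zero) (λ a → ∑ (⨉ (X ∘ suc)) λ as → f (a , as)) ∎
    where
    e₀ = enumeration (X zero)
    e₁ = enumeration (⨉ (X ∘ suc))
    e  = ↔-trans (Fin.*↔× {size (X zero)} {size (⨉ (X ∘ suc))}) (e₀ ×-↔ e₁)

  -- Generalised distributivity: expanding the product picks one summand from each factor, and these
  -- picks are exactly the tuples.
  ∏ᵢ-∑ : ∀ {n} (X : Fin n → NonemptyFiniteSet) (f : ∀ i → Element (X i) → ℝ) →
         ∏ᵢ (λ i → ∑ (X i) (f i)) ≈ ∑ (⨉ X) (λ x → ∏ᵢ λ i → f i (lookup x i))
  -- There is one empty tuple, and it contributes the empty product, so the right side is `1# + 0#`.
  ∏ᵢ-∑ {zero}  X f = sym (+-identityʳ 1#)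
  ∏ᵢ-∑ {suc n} X f = begin-equality
    ∑ (X zero) (f zero) * ∏ᵢ (λ i → ∑ (X (suc i)) (f (suc i)))
      ≈⟨ *-congˡ (∏ᵢ-∑ (X ∘ suc) (λ i → f (suc i))) ⟩
    ∑ (X zero) (f zero) * ∑ (⨉ (X ∘ suc)) ∏f₊
      ≈⟨ *-distribʳ-∑ (X zero) _ (f zero) ⟩
    ∑ (X zero) (λ a → f zero a * ∑ (⨉ (X ∘ suc)) ∏f₊)
      ≈⟨ ∑-cong (X zero) (λ a → *-distribˡ-∑ (⨉ (X ∘ suc)) (f zero a) ∏f₊) ⟩
    ∑ (X zero) (λ a → ∑ (⨉ (X ∘ suc)) λ as → f zero a * ∏f₊ as)
      ≈⟨ ∑-⨉-suc X ∏f ⟨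
    ∑ (⨉ X) ∏f ∎
    where
    ∏f : Element (⨉ X) → ℝ
    ∏f x = ∏ᵢ λ i → f i (lookup {A = Element ∘ X} x i)

    ∏f₊ : Element (⨉ (X ∘ suc)) → ℝ
    ∏f₊ as = ∏ᵢ λ i → f (suc i) (lookup {A = Element ∘ X ∘ suc} as i)

  module _ {A : Set} {a : A} {xs : List A} {f : A → ℝ} where

    ≤-maximum : ∀ {x} → x ∈ xs → f x ≤ maximum a xs f
    ≤-maximum x∈xs = All.lookup (xs≤max (f a) (map f xs)) (∈-map⁺ f x∈xs)

    minimum-≤ : ∀ {x} → x ∈ xs → minimum a xs f ≤ f x
    minimum-≤ x∈xs = All.lookup (min≤xs (f a) (map f xs)) (∈-map⁺ f x∈xs)

    -- The minimum is either the default value `f a` or one of the listed values. This transfers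
    -- positivity of all ratios to `M-min`.
    minimum-all : ∀ {P : ℝ → Set} → P (f a) → (∀ {x} → x ∈ xs → P (f x)) → P (minimum a xs f)
    minimum-all {P} Pa Pxs = argmin-all id {P = P} Pa (All.map⁺ (All.tabulate Pxs))

  ≤-Max : ∀ W (f : Element W → ℝ) w → f w ≤ Max W f
  ≤-Max W f w = ≤-maximum (∈-elements W w)

  -- The maximum over a list is one of its entries or the default, and here the default is itself a
  -- value of `f`. The maximiser obtained this way carries the arguments about `Max` below.
  Max-attained : ∀ W (f : Element W → ℝ) → ∃ λ w → Max W f ≡ f w
  Max-attained W f = argmax-all id {P = λ v → ∃ λ w → v ≡ f w}
    (point W , ≡.refl) (All.map⁺ (All.universal (λ w → w , ≡.refl) (elements W)))

  Max-least : ∀ W {f : Element W → ℝ} {b} → (∀ w → f w ≤ b) → Max W f ≤ b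
  Max-least W {f} {b} f≤b with Max-attained W f
  ... | w , eq = ≡.subst (_≤ b) (≡.sym eq) (f≤b w)

  Max-mono : ∀ W {f h : Element W → ℝ} → (∀ w → f w ≤ h w) → Max W f ≤ Max W h
  Max-mono W f≤h = Max-least W λ w → ≤-trans (f≤h w) (≤-Max W _ w)

  Max-cong : ∀ W {f h : Element W → ℝ} → (∀ w → f w ≈ h w) → Max W f ≈ Max W h
  Max-cong W f≈h = antisym (Max-mono W (≤-reflexive ∘ f≈h)) (Max-mono W (≤-reflexive ∘ sym ∘ f≈h))

  Max-nonNeg : ∀ W {f : Element W → ℝ} → (∀ w → 0# ≤ f w) → 0# ≤ Max W f
  Max-nonNeg W 0≤f = ≤-trans (0≤f (point W)) (≤-Max W _ (point W))

  *-distribˡ-Max : ∀ W {c} (f : Element W → ℝ) → 0# ≤ c → c * Max W f ≈ Max W (λ w → c * f w)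
  *-distribˡ-Max W {c} f 0≤c with Max-attained W f
  ... | w , eq = antisym
    (≡.subst (λ v → c * v ≤ Max W (λ w → c * f w)) (≡.sym eq) (≤-Max W (λ w → c * f w) w))
    (Max-least W λ w → *-monoˡ-≤-nonNeg 0≤c (≤-Max W f w))

  tuple : ∀ {n} {A : Fin n → Set} → (∀ i → A i) → Tuple n A
  tuple {zero}  a = tt
  tuple {suc n} a = a zero , tuple (a ∘ suc)

  lookup-tuple : ∀ {n} {A : Fin n → Set} (a : ∀ i → A i) i → lookup (tuple {A = A} a) i ≡ a i
  lookup-tuple a zero    = ≡.refl
  lookup-tuple a (suc i) = lookup-tuple (a ∘ suc) i

  -- The coordinates of `w` can be chosen independently: the tuple of coordinatewise maximisers
  -- attains the left side. No other tuple exceeds it, because a product of nonnegative factors is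
  -- monotone in each of them.
  ∏ᵢ-Max : ∀ {n} (W : Fin n → NonemptyFiniteSet) (f : ∀ i → Element (W i) → ℝ) →
           (∀ i w → 0# ≤ f i w) →
           ∏ᵢ (λ i → Max (W i) (f i)) ≈ Max (⨉ W) (λ w → ∏ᵢ λ i → f i (lookup w i))
  ∏ᵢ-Max W f 0≤f = antisym
    (≤-trans (≤-reflexive (Product.sum-cong-≋ attained)) (≤-Max (⨉ W) _ (tuple best)))
    (Max-least (⨉ W) λ w → ∏ᵢ-mono (λ i → 0≤f i _) λ i → ≤-Max (W i) (f i) (lookup w i))
    where
    best : ∀ i → Element (W i)
    best i = proj₁ (Max-attained (W i) (f i))

    attained : ∀ i → Max (W i) (f i) ≈ f i (lookup (tuple best) i)
    attained i = reflexive (≡.trans (proj₂ (Max-attained (W i) (f i)))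
                                    (≡.cong (f i) (≡.sym (lookup-tuple best i))))

-- Vulnerabilities as maxima of sums, and bounds on marginals.

module Vulnerability (R : RealNumbers) where
  open RealNumbers R
  open Leakage R
  open OrderedField R
  open BigOperators R
  open NonemptyFiniteSet using (_≟ᴱ_)
  open Relation.Binary.Reasoning.PartialOrder poset

  module _ (W X : NonemptyFiniteSet) where

    -- The common shape of both vulnerabilities, by definition: `priorV` is the `value` of
    -- `π x * g w x`, and `posteriorV` is the sum over `y` of the `value` of `π x * C x y * g w x`.
    value : (Element W → Element X → ℝ) → ℝ
    value a = Max W λ w → ∑ X (a w)

    value-mono : ∀ {a b} → (∀ w x → a w x ≤ b w x) → value a ≤ value b
    value-mono a≤b = Max-mono W λ w → ∑-mono X (a≤b w)

    value-cong : ∀ {a b} → (∀ w x → a w x ≈ b w x) → value a ≈ value b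
    value-cong a≈b = Max-cong W λ w → ∑-cong X (a≈b w)

    value-nonNeg : ∀ {a} → (∀ w x → 0# ≤ a w x) → 0# ≤ value a
    value-nonNeg 0≤a = Max-nonNeg W λ w → ∑-nonNeg X (0≤a w)

    *-distribˡ-value : ∀ {c} a → 0# ≤ c → c * value a ≈ value (λ w x → c * a w x)
    *-distribˡ-value {c} a 0≤c = trans (*-distribˡ-Max W _ 0≤c) (Max-cong W λ w → *-distribˡ-∑ X c (a w))

  -- The product passes inside the maximum by `∏ᵢ-Max`, as the inner sums are nonnegative, and then
  -- inside the sum by `∏ᵢ-∑` for each fixed `w`.
  ∏ᵢ-value : ∀ {n} (W X : Fin n → NonemptyFiniteSet) (a : ∀ i → Element (W i) → Element (X i) → ℝ) →
             (∀ i w x → 0# ≤ a i w x) →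
             ∏ᵢ (λ i → value (W i) (X i) (a i)) ≈
             value (⨉ W) (⨉ X) (λ w x → ∏ᵢ λ i → a i (lookup w i) (lookup x i))
  ∏ᵢ-value W X a 0≤a = trans
    (∏ᵢ-Max W _ λ i w → ∑-nonNeg (X i) (0≤a i w))
    (Max-cong (⨉ W) λ w → ∏ᵢ-∑ X λ i → a i (lookup w i))

  -- A guess `w` that ignores the output is still available after observing `y`. Formally, `1#` is
  -- replaced by the row sum of `C`, the two sums are exchanged, and for each `y` the fixed `w` is
  -- bounded by the best one. The inequality carries positivity from prior to posterior
  -- vulnerabilities.
  priorV≤posteriorV : ∀ W X Y g π C → IsChannel X Y C →
                      priorV W X g π ≤ posteriorV W X g Y π C
  priorV≤posteriorV W X Y g π C C-channel = Max-least W λ w → begin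
    ∑ X (λ x → π x * g w x)
      ≈⟨ ∑-cong X (λ x → *-congʳ {g w x} (begin-equality
           π x                        ≈⟨ *-identityʳ _ ⟨
           π x * 1#                   ≈⟨ *-congˡ {π x} (IsDistribution.total (C-channel x)) ⟨
           π x * ∑ Y (C x)            ≈⟨ *-distribˡ-∑ Y (π x) (C x) ⟩
           ∑ Y (λ y → π x * C x y)    ∎)) ⟩
    ∑ X (λ x → ∑ Y (λ y → π x * C x y) * g w x)
      ≈⟨ ∑-cong X (λ x → *-distribʳ-∑ Y (g w x) (λ y → π x * C x y)) ⟩
    ∑ X (λ x → ∑ Y (λ y → π x * C x y * g w x))
      ≈⟨ ∑-comm X Y (λ x y → π x * C x y * g w x) ⟩
    ∑ Y (λ y → ∑ X λ x → π x * C x y * g w x)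
      ≤⟨ ∑-mono Y (λ y → ≤-Max W (λ w → ∑ X λ x → π x * C x y * g w x) w) ⟩
    posteriorV W X g Y π C ∎

  module _ {n} (X : Fin n → NonemptyFiniteSet) (π : Element (⨉ X) → ℝ) (0≤π : ∀ x → 0# ≤ π x) where

    private
      restricted-nonNeg : ∀ i a x → 0# ≤ (if does (_≟ᴱ_ (X i) (lookup x i) a) then π x else 0#)
      restricted-nonNeg i a x with does (_≟ᴱ_ (X i) (lookup x i) a)
      ... | true  = 0≤π x
      ... | false = ≤-refl

    marginal-nonNeg : ∀ i a → 0# ≤ marginal X π i a
    marginal-nonNeg i a = ∑-nonNeg (⨉ X) (restricted-nonNeg i a)

    -- The marginal at `lookup x i` is a sum of nonnegative terms, and its term at `x` is `π x`,
    -- because the test there compares `lookup x i` with itself.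
    ≤-marginal : ∀ x i → π x ≤ marginal X π i (lookup x i)
    ≤-marginal x i = ≡.subst (λ d → (if d then π x else 0#) ≤ marginal X π i (lookup x i))
      (dec-true (_≟ᴱ_ (X i) (lookup x i) (lookup x i)) ≡.refl)
      (term≤∑ (⨉ X) (restricted-nonNeg i (lookup x i)) x)

-- From multiplicative bounds to bounds on logarithms.

module Logarithm (R : RealNumbers) (log₂ : RealNumbers.ℝ R → RealNumbers.ℝ R) (isLog₂ : IsLog₂ R log₂) where
  open RealNumbers R
  open Leakage R
  open OrderedField R
  open BigOperators R
  open IsLog₂ isLog₂
  open Relation.Binary.Reasoning.PartialOrder poset
  open Algebra.Properties.Ring ring using (-‿+-comm)
  open Algebra.Solver.CommutativeMonoid +-commutativeMonoid using (solve; _⊕_; _⊜_)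

  -- Turns the sum of the individual leakages into a single log-ratio of products. The product law
  -- of `log₂` is available only at positive arguments, hence the positivity of every factor.
  ∑ᵢ-log-ratio : ∀ {n} {p q : Fin n → ℝ} → (∀ i → 0# < p i) → (∀ i → 0# < q i) →
                 ∑ᵢ (λ i → - log₂ (p i) + log₂ (q i)) ≈ - log₂ (∏ᵢ p) + log₂ (∏ᵢ q)
  -- Both empty products are `1#`, so the right side cancels whatever the value of `log₂ 1#`.
  ∑ᵢ-log-ratio {zero} 0<p 0<q = sym (-‿inverseˡ (log₂ 1#))
  ∑ᵢ-log-ratio {suc n} {p} {q} 0<p 0<q = begin-equality
    (- log₂ p₀ + log₂ q₀) + ∑ᵢ (λ i → - log₂ (p (suc i)) + log₂ (q (suc i)))
      ≈⟨ +-congˡ (∑ᵢ-log-ratio (0<p ∘ suc) (0<q ∘ suc)) ⟩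
    (- log₂ p₀ + log₂ q₀) + (- log₂ p₊ + log₂ q₊)
      ≈⟨ solve 4 (λ a b c d → (a ⊕ b) ⊕ (c ⊕ d) ⊜ (a ⊕ c) ⊕ (b ⊕ d)) refl _ _ _ _ ⟩
    (- log₂ p₀ + - log₂ p₊) + (log₂ q₀ + log₂ q₊)
      ≈⟨ +-congʳ (-‿+-comm _ _) ⟩
    - (log₂ p₀ + log₂ p₊) + (log₂ q₀ + log₂ q₊)
      ≈⟨ +-cong (-‿cong (log-* (0<p zero) (∏ᵢ-positive (0<p ∘ suc))))
                (log-* (0<q zero) (∏ᵢ-positive (0<q ∘ suc))) ⟨
    - log₂ (∏ᵢ p) + log₂ (∏ᵢ q) ∎
    where
    p₀ = p zero
    q₀ = q zero
    p₊ = ∏ᵢ (p ∘ suc)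
    q₊ = ∏ᵢ (q ∘ suc)

  -- This is `q / p ≤ k * (q′ / p′)` under the logarithm. The hypothesis is cross-multiplied so that
  -- `log₂` is applied to products only; the terms are then moved across additively.
  log-ratio-≤ : ∀ {p q p′ q′ k} → 0# < p → 0# < q → 0# < p′ → 0# < q′ → 0# < k →
                q * p′ ≤ k * (q′ * p) →
                - log₂ p + log₂ q ≤ - log₂ p′ + log₂ q′ + log₂ k
  log-ratio-≤ {p} {q} {p′} {q′} {k} 0<p 0<q 0<p′ 0<q′ 0<k qp′≤kq′p = begin
    - log₂ p + log₂ q               ≈⟨ +-comm _ _ ⟩
    log₂ q - log₂ p                 ≤⟨ +≤⇒≤- (≤-trans (≤-reflexive swap) (≤+⇒-≤ additive)) ⟩
    log₂ k + log₂ q′ - log₂ p′      ≈⟨ solve 3 (λ a b c → (a ⊕ b) ⊕ c ⊜ (c ⊕ b) ⊕ a) refl _ _ _ ⟩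
    - log₂ p′ + log₂ q′ + log₂ k    ∎
    where
    swap : log₂ q - log₂ p + log₂ p′ ≈ log₂ q + log₂ p′ - log₂ p
    swap = solve 3 (λ a b c → (a ⊕ b) ⊕ c ⊜ (a ⊕ c) ⊕ b) refl _ _ _

    additive : log₂ q + log₂ p′ ≤ log₂ k + log₂ q′ + log₂ p
    additive = begin
      log₂ q + log₂ p′               ≈⟨ log-* 0<q 0<p′ ⟨
      log₂ (q * p′)                  ≤⟨ log-mono (*-positive 0<q 0<p′) qp′≤kq′p ⟩
      log₂ (k * (q′ * p))            ≈⟨ log-* 0<k (*-positive 0<q′ 0<p) ⟩
      log₂ k + log₂ (q′ * p)         ≈⟨ +-congˡ (log-* 0<q′ 0<p) ⟩
      log₂ k + (log₂ q′ + log₂ p)    ≈⟨ +-assoc _ _ _ ⟨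
      log₂ k + log₂ q′ + log₂ p      ∎

  -- Both `p′ / p` and `q′ / q` lie between `m` and `M`, so their quotient lies between `m / M` and
  -- `M / m`. Each bound pairs the upper estimate of one with the lower estimate of the other.
  log-ratio-sandwich : ∀ {m M p q p′ q′} →
    0# < m → 0# < M → 0# < p → 0# < q → 0# < p′ → 0# < q′ →
    m * p ≤ p′ → p′ ≤ M * p → m * q ≤ q′ → q′ ≤ M * q →
    (- log₂ p′ + log₂ q′ - log₂ (M ÷ m) ≤ - log₂ p + log₂ q) ×
    (- log₂ p + log₂ q ≤ - log₂ p′ + log₂ q′ + log₂ (M ÷ m))
  log-ratio-sandwich {m} {M} 0<m 0<M 0<p 0<q 0<p′ 0<q′ mp≤p′ p′≤Mp mq≤q′ q′≤Mq =
    ≤+⇒-≤ (log-ratio-≤ 0<p′ 0<q′ 0<p 0<q 0<k (cross (proj₁ 0<p) (proj₁ 0<q) q′≤Mq mp≤p′)) ,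
    log-ratio-≤ 0<p 0<q 0<p′ 0<q′ 0<k
      (≤-trans (≤-reflexive (*-comm _ _))
        (≤-trans (cross (proj₁ 0<q) (proj₁ 0<p) p′≤Mp mq≤q′) (≤-reflexive (*-congˡ (*-comm _ _)))))
    where
    open Algebra.Solver.CommutativeMonoid *-commutativeMonoid
      using () renaming (solve to solve*; _⊕_ to _⊗_; _⊜_ to _⊜*_)

    0<k : 0# < M ÷ m
    0<k = ÷-positive 0<M 0<m

    cross : ∀ {r s r′ s′} → 0# ≤ r → 0# ≤ s → s′ ≤ M * s → m * r ≤ r′ → s′ * r ≤ M ÷ m * (s * r′)
    cross {r} {s} {r′} {s′} 0≤r 0≤s s′≤Ms mr≤r′ = begin
      s′ * r                  ≈⟨ *-comm s′ r ⟩
      r * s′                  ≤⟨ *-monoˡ-≤-nonNeg 0≤r s′≤Ms ⟩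
      -- Writing `M` as `M ÷ m * m` frees a factor `m`, which joins `r` so that the lower estimate
      -- applies.
      r * (M * s)             ≈⟨ *-congˡ (*-congʳ (÷-*-cancel M (0<⇒≉0 0<m))) ⟨
      r * (M ÷ m * m * s)     ≈⟨ solve* 4 (λ r k m s → r ⊗ ((k ⊗ m) ⊗ s) ⊜* k ⊗ (s ⊗ (m ⊗ r))) refl r (M ÷ m) m s ⟩
      M ÷ m * (s * (m * r))   ≤⟨ *-monoˡ-≤-nonNeg (proj₁ 0<k) (*-monoˡ-≤-nonNeg 0≤s mr≤r′) ⟩
      M ÷ m * (s * r′)        ∎

-- Comparing joint vulnerabilities with products of individual ones.

module Comparison (R : RealNumbers) where
  open RealNumbers R
  open Leakage R
  open OrderedField R
  open BigOperators R
  open Vulnerability R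
  open NonemptyFiniteSet using (∈-elements)
  open Relation.Binary.Reasoning.PartialOrder poset

  module Bounds {n : ℕ} (X Y W : Fin n → NonemptyFiniteSet)
           (gᵢ : ∀ i → Element (W i) → Element (X i) → ℝ)
           (gᵢ-gain : ∀ i → IsGain (W i) (X i) (gᵢ i))
           (g : Element (⨉ W) → Element (⨉ X) → ℝ)
           (g-gain : IsGain (⨉ W) (⨉ X) g)
           (g-joint : IsJointGain W X gᵢ g)
           (π : Element (⨉ X) → ℝ)
           (π-distribution : IsDistribution (⨉ X) π)
           (π-supported : JointlySupported X π)
           (V>0 : 0# < priorV (⨉ W) (⨉ X) g π)
           (C : ∀ i → Element (X i) → Element (Y i) → ℝ)
           (C-channel : ∀ i → IsChannel (X i) (Y i) (C i)) where

    open Support (⨉ W) (⨉ X) g π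
    open IsDistribution π-distribution renaming (nonNegative to 0≤π)

    private
      M m : ℝ
      M = M-max W X gᵢ g π V>0
      m = M-min W X gᵢ g π V>0

      πᵢ : ∀ i → Element (X i) → ℝ
      πᵢ = marginal X π

      a b : Element (⨉ W) → Element (⨉ X) → ℝ
      a w x = π x * g w x
      b w x = ∏ᵢ λ i → πᵢ i (lookup x i) * gᵢ i (lookup w i) (lookup x i)

      0≤πᵢ : ∀ i x → 0# ≤ πᵢ i x
      0≤πᵢ = marginal-nonNeg X π 0≤π

      0≤g : ∀ w x → 0# ≤ g w x
      0≤g w x = proj₁ (g-gain w x)

      0≤gᵢ : ∀ i w x → 0# ≤ gᵢ i w x
      0≤gᵢ i w x = proj₁ (gᵢ-gain i w x)

      0≤C : ∀ i x y → 0# ≤ C i x y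
      0≤C i x = IsDistribution.nonNegative (C-channel i x)

      -- Separates priors from gains: joint support concerns the first product, the joint-gain
      -- condition the second.
      b-factor : ∀ w x → b w x ≈ ∏ᵢ (λ i → πᵢ i (lookup x i)) * ∏ᵢ (λ i → gᵢ i (lookup w i) (lookup x i))
      b-factor w x = Product.∑-distrib-+ (λ i → πᵢ i (lookup x i)) (λ i → gᵢ i (lookup w i) (lookup x i))

      0≤a : ∀ w x → 0# ≤ a w x
      0≤a w x = *-nonNegative (0≤π x) (0≤g w x)

      0≤b : ∀ w x → 0# ≤ b w x
      0≤b w x = ∏ᵢ-nonNeg λ i → *-nonNegative (0≤πᵢ i _) (0≤gᵢ i _ _)

      -- If `π x` is positive, so is each marginal above it. If `g w x` is nonzero, the joint-gain
      -- condition keeps the product of the individual gains nonzero. Hence every ratio on the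
      -- support is positive.
      a≉0⇒0<b : ∀ w x → ¬ (a w x ≈ 0#) → 0# < b w x
      a≉0⇒0<b w x a≉0 = nonNeg∧≉0⇒0< (0≤b w x) λ b≈0 →
        *-≉0 (0<⇒≉0 (∏ᵢ-positive λ i → 0<-≤-trans (nonNeg∧≉0⇒0< (0≤π x) (*-≉0ˡ a≉0)) (≤-marginal X π 0≤π x i)))
             (λ G≈0 → *-≉0ʳ a≉0 (Equivalence.from (g-joint w x) G≈0))
             (trans (sym (b-factor w x)) b≈0)

      -- Proved by contraposition, equality being decidable. A nonzero `b w x` makes both of its
      -- factors nonzero; joint support then gives `π x` nonzero, and the joint-gain condition gives
      -- `g w x` nonzero.
      a≈0⇒b≈0 : ∀ w x → a w x ≈ 0# → b w x ≈ 0#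
      a≈0⇒b≈0 w x a≈0 with b w x ≟ 0#
      ... | yes b≈0 = b≈0
      ... | no  b≉0 = contradiction a≈0 (*-≉0
        (π-supported x (*-≉0ˡ b≉0′))
        (*-≉0ʳ b≉0′ ∘ Equivalence.to (g-joint w x)))
        where
        b≉0′ : ¬ (∏ᵢ (λ i → πᵢ i (lookup x i)) * ∏ᵢ (λ i → gᵢ i (lookup w i) (lookup x i)) ≈ 0#)
        b≉0′ = b≉0 ∘ trans (b-factor w x)

      0<ratio : ∀ p → InS p → 0# < ratio W X gᵢ g π p
      0<ratio (w , x) s = ÷-positive (a≉0⇒0<b w x s) (nonNeg∧≉0⇒0< (0≤a w x) s)

      ∈-supportPairs : ∀ p → InS p → p ∈ supportPairs
      ∈-supportPairs (w , x) =
        ∈-filter⁺ InS? (∈-cartesianProduct⁺ (∈-elements (⨉ W) w) (∈-elements (⨉ X) x))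

    0<M-min : 0# < m
    -- The default entry of the minimum is the ratio at `p₀`, a support pair as well, so it is
    -- positive like the listed ones.
    0<M-min = minimum-all {a = p₀} {xs = supportPairs} {P = 0# <_} (0<ratio p₀ p₀∈S)
      λ {p} p∈ → 0<ratio p (proj₂ (∈-filter⁻ InS? {xs = pairs} p∈))
      where
      p₀ = proj₁ (positive⇒supported V>0)
      p₀∈S = proj₂ (positive⇒supported V>0)

    0<M-max : 0# < M
    0<M-max = 0<-≤-trans (0<ratio _ s) (≤-maximum (∈-supportPairs _ s))
      where s = proj₂ (positive⇒supported V>0)

    private
      m*a≤b : ∀ w x → m * a w x ≤ b w x
      m*a≤b w x with InS? (w , x)
      ... | yes s = begin
        m * a w x                                  ≈⟨ *-comm _ _ ⟩
        a w x * m                                  ≤⟨ *-monoˡ-≤-nonNeg (0≤a w x) (minimum-≤ (∈-supportPairs _ s)) ⟩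
        a w x * ratio W X gᵢ g π (w , x)           ≈⟨ *-comm _ _ ⟩
        b w x ÷ a w x * a w x                      ≈⟨ ÷-*-cancel (b w x) s ⟩
        b w x                                      ∎
      ... | no ¬s = ≤-trans (≤-reflexive (trans (*-congˡ a≈0) (zeroʳ m))) (0≤b w x)
        where a≈0 = decidable-stable (a w x ≟ 0#) ¬s

      b≤M*a : ∀ w x → b w x ≤ M * a w x
      b≤M*a w x with InS? (w , x)
      ... | yes s = begin
        b w x                                      ≈⟨ ÷-*-cancel (b w x) s ⟨
        b w x ÷ a w x * a w x                      ≈⟨ *-comm _ _ ⟩
        a w x * ratio W X gᵢ g π (w , x)           ≤⟨ *-monoˡ-≤-nonNeg (0≤a w x) (≤-maximum (∈-supportPairs _ s)) ⟩
        a w x * M                                  ≈⟨ *-comm _ _ ⟩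
        M * a w x                                  ∎
      -- Off the support no ratio controls `b w x`; the bound holds there because `b w x` vanishes
      -- together with `a w x`.
      ... | no ¬s = ≤-trans (≤-reflexive (a≈0⇒b≈0 w x a≈0)) (*-nonNegative (proj₁ 0<M-max) (0≤a w x))
        where a≈0 = decidable-stable (a w x ≟ 0#) ¬s

      p q : ℝ
      p = priorV (⨉ W) (⨉ X) g π
      q = posteriorV (⨉ W) (⨉ X) g (⨉ Y) π (parallel X Y C)

      pᵢ qᵢ : Fin n → ℝ
      pᵢ i = priorV (W i) (X i) (gᵢ i) (πᵢ i)
      qᵢ i = posteriorV (W i) (X i) (gᵢ i) (Y i) (πᵢ i) (C i)

      ∏pᵢ≈value-b : ∏ᵢ pᵢ ≈ value (⨉ W) (⨉ X) b
      ∏pᵢ≈value-b = ∏ᵢ-value W X _ λ i w x → *-nonNegative (0≤πᵢ i x) (0≤gᵢ i w x)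

      c : Element (⨉ Y) → Element (⨉ X) → ℝ
      c y x = parallel X Y C x y

      0≤c : ∀ y x → 0# ≤ c y x
      0≤c y x = ∏ᵢ-nonNeg λ i → 0≤C i _ _

      0≤πCg : ∀ i y w x → 0# ≤ πᵢ i x * C i x y * gᵢ i w x
      0≤πCg i y w x = *-nonNegative (*-nonNegative (0≤πᵢ i x) (0≤C i x y)) (0≤gᵢ i w x)

      middle-swap : ∀ x y z → x * y * z ≈ y * (x * z)
      middle-swap x y z = trans (*-congʳ (*-comm x y)) (*-assoc y x z)

      -- The sums over the individual outputs expand into one sum over joint outputs `y`. For each
      -- `y` the product of maxima of sums becomes a joint `value`, and collecting the channel
      -- entries into `c y x` leaves `b w x`.
      ∏qᵢ≈∑value-cb : ∏ᵢ qᵢ ≈ ∑ (⨉ Y) λ y → value (⨉ W) (⨉ X) λ w x → c y x * b w x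
      ∏qᵢ≈∑value-cb = begin-equality
        ∏ᵢ qᵢ
          ≈⟨ ∏ᵢ-∑ Y (λ i y → value (W i) (X i) λ w x → πᵢ i x * C i x y * gᵢ i w x) ⟩
        ∑ (⨉ Y) (λ y → ∏ᵢ λ i → value (W i) (X i) λ w x → πᵢ i x * C i x (lookup y i) * gᵢ i w x)
          ≈⟨ ∑-cong (⨉ Y) (λ y → ∏ᵢ-value W X _ λ i → 0≤πCg i (lookup y i)) ⟩
        ∑ (⨉ Y) (λ y → value (⨉ W) (⨉ X) λ w x → ∏ᵢ λ i →
          πᵢ i (lookup x i) * C i (lookup x i) (lookup y i) * gᵢ i (lookup w i) (lookup x i))
          ≈⟨ ∑-cong (⨉ Y) (λ y → value-cong (⨉ W) (⨉ X) λ w x →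
               trans (Product.sum-cong-≋ λ i →
                       middle-swap (πᵢ i (lookup x i)) (C i (lookup x i) (lookup y i)) (gᵢ i (lookup w i) (lookup x i)))
                     (Product.∑-distrib-+
                       (λ i → C i (lookup x i) (lookup y i))
                       (λ i → πᵢ i (lookup x i) * gᵢ i (lookup w i) (lookup x i)))) ⟩
        ∑ (⨉ Y) (λ y → value (⨉ W) (⨉ X) λ w x → c y x * b w x) ∎

      -- Carries `k` through the sums and the maximum down to `a w x`, where the pointwise bounds
      -- apply under the nonnegative weight `c y x`.
      scaled-q : ∀ {k} → 0# ≤ k →
                 k * q ≈ ∑ (⨉ Y) λ y → value (⨉ W) (⨉ X) λ w x → c y x * (k * a w x)
      scaled-q {k} 0≤k = trans (*-distribˡ-∑ (⨉ Y) k (λ y → value (⨉ W) (⨉ X) (πcg y))) (∑-cong (⨉ Y) λ y →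
        trans (*-distribˡ-value (⨉ W) (⨉ X) (πcg y) 0≤k) (value-cong (⨉ W) (⨉ X) λ w x →
          trans (*-congˡ (middle-swap (π x) (c y x) (g w x))) (x∙yz≈y∙xz k (c y x) (a w x))))
        where
        open Algebra.Properties.CommutativeSemigroup *-commutativeSemigroup using (x∙yz≈y∙xz)

        πcg : Element (⨉ Y) → Element (⨉ W) → Element (⨉ X) → ℝ
        πcg y w x = π x * c y x * g w x

      ∑value-c-mono : ∀ {d e : Element (⨉ W) → Element (⨉ X) → ℝ} → (∀ w x → d w x ≤ e w x) →
        ∑ (⨉ Y) (λ y → value (⨉ W) (⨉ X) λ w x → c y x * d w x) ≤
        ∑ (⨉ Y) (λ y → value (⨉ W) (⨉ X) λ w x → c y x * e w x)
      ∑value-c-mono d≤e = ∑-mono (⨉ Y) λ y → value-mono (⨉ W) (⨉ X) λ w x →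
        *-monoˡ-≤-nonNeg (0≤c y x) (d≤e w x)

    M-min*priorV≤∏ : m * p ≤ ∏ᵢ pᵢ
    M-min*priorV≤∏ = begin
      m * p                                  ≈⟨ *-distribˡ-value (⨉ W) (⨉ X) a (proj₁ 0<M-min) ⟩
      value (⨉ W) (⨉ X) (λ w x → m * a w x)  ≤⟨ value-mono (⨉ W) (⨉ X) m*a≤b ⟩
      value (⨉ W) (⨉ X) b                    ≈⟨ ∏pᵢ≈value-b ⟨
      ∏ᵢ pᵢ                                  ∎

    ∏≤M-max*priorV : ∏ᵢ pᵢ ≤ M * p
    ∏≤M-max*priorV = begin
      ∏ᵢ pᵢ                                  ≈⟨ ∏pᵢ≈value-b ⟩
      value (⨉ W) (⨉ X) b                    ≤⟨ value-mono (⨉ W) (⨉ X) b≤M*a ⟩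
      value (⨉ W) (⨉ X) (λ w x → M * a w x)  ≈⟨ *-distribˡ-value (⨉ W) (⨉ X) a (proj₁ 0<M-max) ⟨
      M * p                                  ∎

    M-min*posteriorV≤∏ : m * q ≤ ∏ᵢ qᵢ
    M-min*posteriorV≤∏ = begin
      m * q                                                               ≈⟨ scaled-q (proj₁ 0<M-min) ⟩
      ∑ (⨉ Y) (λ y → value (⨉ W) (⨉ X) λ w x → c y x * (m * a w x))       ≤⟨ ∑value-c-mono m*a≤b ⟩
      ∑ (⨉ Y) (λ y → value (⨉ W) (⨉ X) λ w x → c y x * b w x)             ≈⟨ ∏qᵢ≈∑value-cb ⟨
      ∏ᵢ qᵢ                                                               ∎

    ∏≤M-max*posteriorV : ∏ᵢ qᵢ ≤ M * q
    ∏≤M-max*posteriorV = begin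
      ∏ᵢ qᵢ                                                               ≈⟨ ∏qᵢ≈∑value-cb ⟩
      ∑ (⨉ Y) (λ y → value (⨉ W) (⨉ X) λ w x → c y x * b w x)             ≤⟨ ∑value-c-mono b≤M*a ⟩
      ∑ (⨉ Y) (λ y → value (⨉ W) (⨉ X) λ w x → c y x * (M * a w x))       ≈⟨ scaled-q (proj₁ 0<M-max) ⟨
      M * q                                                               ∎

    -- Positivity is assumed for the joint prior vulnerability `p` alone. Since `m * p ≤ ∏ᵢ pᵢ`, the
    -- product is positive, so none of its factors vanishes.
    0<priorVᵢ : ∀ i → 0# < pᵢ i
    0<priorVᵢ i = nonNeg∧≉0⇒0<
      (value-nonNeg (W i) (X i) λ w x → *-nonNegative (0≤πᵢ i x) (0≤gᵢ i w x))
      (∏ᵢ≉0⇒≉0 (0<⇒≉0 (0<-≤-trans (*-positive 0<M-min V>0) M-min*priorV≤∏)) i)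

    0<posteriorVᵢ : ∀ i → 0# < qᵢ i
    0<posteriorVᵢ i = 0<-≤-trans (0<priorVᵢ i)
      (priorV≤posteriorV (W i) (X i) (Y i) (gᵢ i) (πᵢ i) (C i) (C-channel i))

    -- Positivity returns from the coordinates to the joint channel: the product of the `qᵢ` is
    -- positive and at most `M * q`, so `q` cannot vanish.
    0<posteriorV : 0# < q
    0<posteriorV = nonNeg∧≉0⇒0<
      (∑-nonNeg (⨉ Y) λ y → value-nonNeg (⨉ W) (⨉ X) λ w x →
        *-nonNegative (*-nonNegative (0≤π x) (0≤c y x)) (0≤g w x))
      (*-≉0ʳ (0<⇒≉0 (0<-≤-trans (∏ᵢ-positive 0<posteriorVᵢ) ∏≤M-max*posteriorV)))

proposition3p17 :
  (R : RealNumbers) →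
  let open RealNumbers R
      open Leakage R
  in
  (log₂ : ℝ → ℝ) → IsLog₂ R log₂ →
  (n : ℕ) → .{{_ : NonZero n}} →
  (X Y W : Fin n → NonemptyFiniteSet) →
  (gᵢ : ∀ i → Element (W i) → Element (X i) → ℝ) →
  (∀ i → IsGain (W i) (X i) (gᵢ i)) →
  (g : Element (⨉ W) → Element (⨉ X) → ℝ) →
  IsGain (⨉ W) (⨉ X) g →
  IsJointGain W X gᵢ g →
  (π : Element (⨉ X) → ℝ) →
  IsDistribution (⨉ X) π →
  JointlySupported X π →
  (V>0 : 0# < priorV (⨉ W) (⨉ X) g π) →
  (C : ∀ i → Element (X i) → Element (Y i) → ℝ) →
  (∀ i → IsChannel (X i) (Y i) (C i)) →
  let ΣI  = ∑ᵢ λ i → leakage (W i) (X i) (gᵢ i) log₂ (Y i) (marginal X π i) (C i)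
      I   = leakage (⨉ W) (⨉ X) g log₂ (⨉ Y) π (parallel X Y C)
      gap = log₂ (M-max W X gᵢ g π V>0 ÷ M-min W X gᵢ g π V>0)
  in
  (ΣI - gap ≤ I) × (I ≤ ΣI + gap)
proposition3p17 R log₂ isLog₂ n X Y W gᵢ gᵢ-gain g g-gain g-joint π π-distribution π-supported V>0 C C-channel =
  ≤-trans (+-monoˡ-≤ _ (≤-reflexive ΣI≈)) (proj₁ sandwich) ,
  ≤-trans (proj₂ sandwich) (+-monoˡ-≤ _ (≤-reflexive (sym ΣI≈)))
  where
  open RealNumbers R
  open OrderedField R
  open BigOperators R using (∏ᵢ-positive)
  open Logarithm R log₂ isLog₂
  open Comparison R
  open Bounds X Y W gᵢ gᵢ-gain g g-gain g-joint π π-distribution π-supported V>0 C C-channel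

  ΣI≈ = ∑ᵢ-log-ratio 0<priorVᵢ 0<posteriorVᵢ

  -- The unprimed quantities are the joint vulnerabilities, and the primed ones are the products of
  -- the individual ones, whose log-ratio `ΣI≈` identifies with the sum of leakages.
  sandwich = log-ratio-sandwich 0<M-min 0<M-max V>0 0<posteriorV
    (∏ᵢ-positive 0<priorVᵢ) (∏ᵢ-positive 0<posteriorVᵢ)
    M-min*priorV≤∏ ∏≤M-max*priorV M-min*posteriorV≤∏ ∏≤M-max*posteriorV
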